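{- Let $n \ge 2$ be an integer, let $m$ be a positive integer with $m \equiv 1 \pmod{n}$, and let $c>0$ be a real number. Then $$\beta^n_m(c^n, c) = c.$$
   Context: For positive integers $n, m$ and real numbers $x>0$, $c>0$, the (binomial) biroot approximant of root index $n$ and order $m$ is $$\beta^n_m(x,c) = \frac{\displaystyle\sum_{k=0}^{\lceil m/n \rceil} x^k\, c^{m-nk} \binom{m}{nk}}{\displaystyle\sum_{k=0}^{\lceil m/n \rceil - 1} x^k\, c^{m-nk-1} \binom{m}{nk+1}}.$$ Binomial coefficients $\binom{a}{b}$ with $b>a\ge 0$ are equal to $0$. Exponents of $c$ are integers and may be negative (in which case the binomial coefficient vanishes). -}

module Defs where

open import Algebra.Apartness.Bundles using (HeytingCommutativeRing; HeytingField)
open import Algebra.Bundles using (CommutativeRing)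
import Algebra.Apartness.Properties.HeytingCommutativeRing as HeytingProperties
import Algebra.Properties.Ring as RingProperties
import Algebra.Properties.Semiring.Exp as Exp
import Algebra.Properties.Semiring.Mult as Mult
import Algebra.Properties.Semiring.Sum as Sum
open import Data.Fin.Base using (Fin; toℕ) renaming (zero to fzero; suc to fsuc)
open import Data.Integer.Base as ℤ using (ℤ; +_; -[1+_])
import Data.Integer.DivMod as ℤ
import Data.Integer.Properties as ℤ
open import Data.Nat.Base as ℕ using (ℕ; zero; suc; NonZero)
open import Data.Nat.Combinatorics using (_C_; nC1≡n)
import Data.Nat.Properties as ℕ
open import Data.Product.Base using (∃-syntax; _×_; _,_; proj₁; proj₂)
open import Data.Rational.Unnormalised.Base as ℚᵘ using ()
open import Data.Sum.Base using (_⊎_; inj₁; inj₂)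
open import Level using (_⊔_) renaming (suc to lsuc)
open import Relation.Binary.Core using (Rel)
open import Relation.Binary.PropositionalEquality as ≡ using (_≡_; _≢_)
open import Relation.Binary.Structures using (IsStrictPartialOrder)
open import Relation.Nullary.Negation using (contradiction)

-- The real numbers, axiomatised as a Cauchy-complete Archimedean ordered field.
-- Classically this determines ℝ up to isomorphism.  The axioms are phrased so
-- that they also hold constructively (e.g. for Bishop's reals): the apartness
-- relation of the Heyting field is the relation "x < y or y < x", and by
-- tightness it stands for x ≠ y.
record RealNumbers a ℓ₁ ℓ₂ : Set (lsuc (a ⊔ ℓ₁ ⊔ ℓ₂)) where
  infix 4 _<_

  field
    heytingField : HeytingField a ℓ₁ ℓ₂

  open HeytingField heytingField public

  open HeytingCommutativeRing heytingCommutativeRing public using (commutativeRing)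
  open CommutativeRing commutativeRing public using (semiring; ring)
  open Mult semiring public using () renaming (_×_ to _·_)

  field
    _<_                  : Rel Carrier ℓ₂
    isStrictPartialOrder : IsStrictPartialOrder _≈_ _<_
    #⇒<⊎>                : ∀ {x y} → x # y → x < y ⊎ y < x
    <⇒#                  : ∀ {x y} → x < y → x # y
    0<1                  : 0# < 1#
    +-monoˡ-<            : ∀ {x y} z → x < y → x + z < y + z
    *-pos                : ∀ {x y} → 0# < x → 0# < y → 0# < x * y

  -- s i < s j + ε is required for both orders of i and j, i.e. ∣ s i - s j ∣ < ε.
  IsCauchy : (ℕ → Carrier) → Set (a ⊔ ℓ₂)
  IsCauchy s = ∀ ε → 0# < ε →
    ∃[ N ] (∀ i j → N ℕ.≤ i → N ℕ.≤ j → s i < s j + ε)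

  _ConvergesTo_ : (ℕ → Carrier) → Carrier → Set (a ⊔ ℓ₂)
  s ConvergesTo l = ∀ ε → 0# < ε →
    ∃[ N ] (∀ i → N ℕ.≤ i → s i < l + ε × l < s i + ε)

  field
    archimedean : ∀ x → ∃[ n ] x < n · 1#
    complete    : ∀ s → IsCauchy s → ∃[ l ] s ConvergesTo l

⌈_/_⌉ : (m n : ℕ) .{{_ : NonZero n}} → ℕ
⌈ m / n ⌉ = ℤ.∣ ℚᵘ.ceiling (+ m ℚᵘ./ n) ∣

⌈m/n⌉≢0 : ∀ m n .{{_ : NonZero m}} .{{_ : NonZero n}} → ⌈ m / n ⌉ ≢ 0
⌈m/n⌉≢0 m@(suc _) n@(suc _) eq = contradiction 0≤-m λ ()
  where
  q : ℤ
  q = (ℤ.- + m) ℤ./ (+ n)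

  q≡0 : q ≡ + 0
  q≡0 = ≡.trans (≡.sym (ℤ.neg-involutive q)) (≡.cong ℤ.-_ (ℤ.∣i∣≡0⇒i≡0 eq))

  0≤-m : + 0 ℤ.≤ ℤ.- + m
  0≤-m = ≡.subst (λ z → z ℤ.* + n ℤ.≤ ℤ.- + m) q≡0 (ℤ.[n/d]*d≤n (ℤ.- + m) (+ n))

module Biroot {a ℓ₁ ℓ₂} (ℝ : RealNumbers a ℓ₁ ℓ₂) where
  open RealNumbers ℝ
  open HeytingProperties heytingCommutativeRing using (x-0≈x)
  open RingProperties ring using (-‿distribʳ-*)
  open IsStrictPartialOrder isStrictPartialOrder
    using (<-respʳ-≈; <-respˡ-≈) renaming (trans to <-trans; irrefl to <-irrefl)
  open Exp semiring public using (_^_)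
  open Sum semiring public using (sum; sum-syntax; sum⁺-syntax)

  recip : ∀ x → x # 0# → Carrier
  recip x x#0 = proj₁ (#⇒invertible x#0)

  *-recip : ∀ x (x#0 : x # 0#) → x * recip x x#0 ≈ 1#
  *-recip x x#0 = trans (*-congʳ (sym (x-0≈x x))) (proj₂ (proj₂ (#⇒invertible x#0)))

  infixl 7 _/_[_]
  _/_[_] : ∀ x y → y # 0# → Carrier
  x / y [ y#0 ] = x * recip y y#0

  pos⇒#0 : ∀ {x} → 0# < x → x # 0#
  pos⇒#0 0<x = #-sym (<⇒# 0<x)

  infix 8 _^ℤ_[_]
  _^ℤ_[_] : ∀ x → ℤ → x # 0# → Carrier
  x ^ℤ + k      [ x#0 ] = x ^ k
  x ^ℤ -[1+ k ] [ x#0 ] = recip x x#0 ^ suc k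

  ^-pos : ∀ {x} k → 0# < x → 0# < x ^ k
  ^-pos zero    0<x = 0<1
  ^-pos (suc k) 0<x = *-pos 0<x (^-pos k 0<x)

  +-pos : ∀ {x y} → 0# < x → 0# < y → 0# < x + y
  +-pos {x} {y} 0<x 0<y =
    <-trans 0<y (<-respˡ-≈ (+-identityˡ y) (+-monoˡ-< y 0<x))

  recip-pos : ∀ {x} (0<x : 0# < x) → 0# < recip x (pos⇒#0 0<x)
  recip-pos {x} 0<x = lemma (#⇒<⊎> r#0)
    where
    x#0 = pos⇒#0 0<x
    r   = recip x x#0

    r#0 : r # 0#
    r#0 = HeytingProperties.invertibleʳ⇒# heytingCommutativeRing
      (x , trans (*-congʳ (x-0≈x r)) (trans (*-comm r x) (*-recip x x#0)))

    lemma : r < 0# ⊎ 0# < r → 0# < r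
    lemma (inj₂ 0<r) = 0<r
    lemma (inj₁ r<0) = contradiction (+-pos 0<1 0<-1) (<-irrefl (sym (-‿inverseʳ 1#)))
      where
      0<-r : 0# < - r
      0<-r = <-respˡ-≈ (-‿inverseʳ r) (<-respʳ-≈ (+-identityˡ (- r)) (+-monoˡ-< (- r) r<0))

      0<-1 : 0# < - 1#
      0<-1 = <-respʳ-≈ (trans (sym (-‿distribʳ-* x r)) (-‿cong (*-recip x x#0)))
                       (*-pos 0<x 0<-r)

  ^ℤ-pos : ∀ {x} z (0<x : 0# < x) → 0# < x ^ℤ z [ pos⇒#0 0<x ]
  ^ℤ-pos (+ k)    0<x = ^-pos k 0<x
  ^ℤ-pos -[1+ k ] 0<x = ^-pos (suc k) (recip-pos 0<x)

  ·-pos : ∀ N .{{_ : NonZero N}} {x} → 0# < x → 0# < N · x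
  ·-pos (suc zero)        0<x = <-respʳ-≈ (sym (+-identityʳ _)) 0<x
  ·-pos (suc N@(suc _))   0<x = +-pos 0<x (·-pos N 0<x)

  +-pos-· : ∀ {x y} N → 0# < x → 0# < y → 0# < x + N · y
  +-pos-· zero      0<x 0<y = <-respʳ-≈ (sym (+-identityʳ _)) 0<x
  +-pos-· N@(suc _) 0<x 0<y = +-pos 0<x (·-pos N 0<y)

  sum-≈0⊎pos : ∀ N (w : ℕ → ℕ) (p : ℕ → Carrier) → (∀ k → 0# < p k) →
               (f : Fin N → ℕ) →
               sum (λ i → w (f i) · p (f i)) ≈ 0# ⊎ 0# < sum (λ i → w (f i) · p (f i))
  sum-≈0⊎pos zero    w p 0<p f = inj₁ refl
  sum-≈0⊎pos (suc N) w p 0<p f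
    with w (f fzero) | sum-≈0⊎pos N w p 0<p (λ i → f (fsuc i))
  ... | zero  | inj₁ s≈0 = inj₁ (trans (+-identityˡ _) s≈0)
  ... | zero  | inj₂ 0<s = inj₂ (<-respʳ-≈ (sym (+-identityˡ _)) 0<s)
  ... | suc j | inj₁ s≈0 =
    inj₂ (<-respʳ-≈ (sym (trans (+-congˡ s≈0) (+-identityʳ _))) (·-pos (suc j) (0<p _)))
  ... | suc j | inj₂ 0<s = inj₂ (+-pos (·-pos (suc j) (0<p _)) 0<s)

  sum-pos : ∀ N → N ≢ 0 → (w : ℕ → ℕ) (p : ℕ → Carrier) → (∀ k → 0# < p k) →
            .{{NonZero (w 0)}} → 0# < ∑[ k < N ] (w (toℕ k) · p (toℕ k))
  sum-pos zero    N≢0 w p 0<p = contradiction ≡.refl N≢0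
  sum-pos (suc N) N≢0 w p 0<p with sum-≈0⊎pos N w p 0<p (λ i → suc (toℕ i))
  ... | inj₁ s≈0 =
    <-respʳ-≈ (sym (trans (+-congˡ s≈0) (+-identityʳ _))) (·-pos (w 0) (0<p 0))
  ... | inj₂ 0<s = +-pos (·-pos (w 0) (0<p 0)) 0<s

  numerator : (n m : ℕ) .{{_ : NonZero n}} (x c : Carrier) → c # 0# → Carrier
  numerator n m x c c#0 =
    ∑[ k ≤ ⌈ m / n ⌉ ]
      ((m C (n ℕ.* toℕ k)) ·
       (x ^ toℕ k * c ^ℤ (+ m ℤ.- + (n ℕ.* toℕ k)) [ c#0 ]))

  -- The sum over 0 ≤ k ≤ ⌈ m / n ⌉ - 1, written with a strict upper bound.
  denominator : (n m : ℕ) .{{_ : NonZero n}} (x c : Carrier) → c # 0# → Carrier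
  denominator n m x c c#0 =
    ∑[ k < ⌈ m / n ⌉ ]
      ((m C (n ℕ.* toℕ k ℕ.+ 1)) ·
       (x ^ toℕ k * c ^ℤ (+ m ℤ.- + (n ℕ.* toℕ k) ℤ.- + 1) [ c#0 ]))

  denominator-pos : ∀ n m .{{_ : NonZero n}} .{{_ : NonZero m}} {x c} →
                    0# < x → (0<c : 0# < c) → 0# < denominator n m x c (pos⇒#0 0<c)
  denominator-pos n m {x} {c} 0<x 0<c =
    sum-pos ⌈ m / n ⌉ (⌈m/n⌉≢0 m n)
      (λ k → m C (n ℕ.* k ℕ.+ 1))
      (λ k → x ^ k * c ^ℤ (+ m ℤ.- + (n ℕ.* k) ℤ.- + 1) [ pos⇒#0 0<c ])
      (λ k → *-pos (^-pos k 0<x) (^ℤ-pos (+ m ℤ.- + (n ℕ.* k) ℤ.- + 1) 0<c))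
      {{≡.subst NonZero (≡.sym mC[n*0+1]≡m) (ℕ.≢-nonZero (ℕ.≢-nonZero⁻¹ m))}}
    where
    mC[n*0+1]≡m : m C (n ℕ.* 0 ℕ.+ 1) ≡ m
    mC[n*0+1]≡m = ≡.trans (≡.cong (λ z → m C (z ℕ.+ 1)) (ℕ.*-zeroʳ n)) (nC1≡n m)

  β : (n m : ℕ) .{{_ : NonZero n}} .{{_ : NonZero m}} (x c : Carrier) →
      0# < x → 0# < c → Carrier
  β n m x c 0<x 0<c =
    numerator n m x c c#0 / denominator n m x c c#0
      [ pos⇒#0 (denominator-pos n m 0<x 0<c) ]
    where c#0 = pos⇒#0 0<c

{-# OPTIONS --safe #-}

-- For m = 1 + n q, every term with nonzero binomial coefficient in the numerator
-- at x = c ^ n is a multiple of c ^ m, and every such term in the denominator is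
-- a multiple of c ^ (m - 1).  The symmetry of the binomial coefficients, which
-- exchanges n k and n (q - k) + 1, identifies the two coefficient sums, so the
-- numerator is c times the denominator.
module Submission where

open import Defs
open import Data.Nat using (ℕ; NonZero; _≤_; _%_)
open import Relation.Binary.PropositionalEquality using (_≡_)

import Algebra.Properties.Semiring.Exp as Exp
import Algebra.Properties.Semiring.Mult as Mult
import Algebra.Properties.Semiring.Sum as Sum
open import Data.Fin.Base using (Fin; toℕ; fromℕ; inject₁; opposite)
open import Data.Fin.Permutation using (reverse)
open import Data.Fin.Properties using (toℕ≤pred[n]; toℕ-fromℕ; toℕ-inject₁; opposite-prop)
open import Data.Integer.Base as ℤ using (+_; -[1+_])
import Data.Integer.DivMod as ℤ
import Data.Integer.Properties as ℤ
open import Data.Nat.Base as ℕ using (suc; _∸_; _/_; s≤s)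
open import Data.Nat.Combinatorics using (_C_; nCk≡nC[n∸k]; k>n⇒nCk≡0)
open import Data.Nat.DivMod using (m≡m%n+[m/n]*n; m<n⇒m%n≡m)
import Data.Nat.Properties as ℕ
open import Relation.Binary.PropositionalEquality as ≡ using (cong; cong₂; module ≡-Reasoning)
import Relation.Binary.Reasoning.Setoid as ≈-Reasoning

%≡1⇒≡1+n*[m/n] : ∀ m n .{{_ : NonZero n}} → m % n ≡ 1 → m ≡ suc (n ℕ.* (m / n))
%≡1⇒≡1+n*[m/n] m n m%n≡1 = ≡.trans (m≡m%n+[m/n]*n m n)
  (cong₂ ℕ._+_ m%n≡1 (ℕ.*-comm (m / n) n))

-- The ceiling is the negated integer quotient of `- m` by `n`. For a negative dividend that
-- quotient branches on the remainder of `m`, and remainder 1 selects the branch that rounds away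
-- from zero.
⌈m/n⌉≡1+[m/n] : ∀ m n .{{_ : NonZero n}} → m % n ≡ 1 → ⌈ m / n ⌉ ≡ suc (m / n)
⌈m/n⌉≡1+[m/n] (suc m) n@(suc _) m%n≡1
  rewrite ℤ.div-pos-is-/ℕ -[1+ m ] n {{_}} | m%n≡1 = ≡.refl
⌈m/n⌉≡1+[m/n] 0 (suc _) ()

+m-+n≡+[m∸n] : ∀ {m n} → n ≤ m → + m ℤ.- + n ≡ + (m ∸ n)
+m-+n≡+[m∸n] {m} {n} n≤m = ≡.trans (ℤ.m-n≡m⊖n m n) (ℤ.⊖-≥ n≤m)

-- The two lower indices are complementary: `n(q - k) + (nk + 1) = 1 + nq`.
C-reflect : ∀ n {q k} → k ≤ q →
            suc (n ℕ.* q) C (n ℕ.* (q ∸ k)) ≡ suc (n ℕ.* q) C (n ℕ.* k ℕ.+ 1)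
-- With `nk + 1` in the form `suc (nk)`, the complement `suc (nq) ∸ suc (nk)` computes to `nq ∸ nk`.
C-reflect n {q} {k} k≤q rewrite ℕ.+-comm (n ℕ.* k) 1 = begin
  suc (n ℕ.* q) C (n ℕ.* (q ∸ k))      ≡⟨ cong (suc (n ℕ.* q) C_) (ℕ.*-distribˡ-∸ n q k) ⟩
  suc (n ℕ.* q) C (n ℕ.* q ∸ n ℕ.* k)  ≡⟨ nCk≡nC[n∸k] (s≤s (ℕ.*-monoʳ-≤ n k≤q)) ⟨
  suc (n ℕ.* q) C suc (n ℕ.* k)        ∎
  where open ≡-Reasoning

module _ {a ℓ₁ ℓ₂} (ℝ : RealNumbers a ℓ₁ ℓ₂) where
  open RealNumbers ℝ
  open Biroot ℝ
  open Exp semiring using (^-homo-*; ^-assocʳ; ^-congʳ)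
  open Mult semiring using (×-congʳ; ×-congˡ; ×-cong; ×-comm-*)
  open Sum semiring using (sum-cong-≋; sum-cong-≗; sum-init-last; ∑-permute; *-distribˡ-sum)
  open ≈-Reasoning setoid

  ∑-snoc : ∀ N (f : ℕ → Carrier) → ∑[ k ≤ N ] f (toℕ k) ≈ ∑[ k < N ] f (toℕ k) + f N
  ∑-snoc N f = begin
    ∑[ k ≤ N ] f (toℕ k)                                ≈⟨ sum-init-last (λ (k : Fin (suc N)) → f (toℕ k)) ⟩
    ∑[ k < N ] f (toℕ (inject₁ k)) + f (toℕ (fromℕ N))  ≡⟨ cong₂ _+_
      (sum-cong-≗ {N} (λ k → cong f (toℕ-inject₁ k))) (cong f (toℕ-fromℕ N)) ⟩
    ∑[ k < N ] f (toℕ k) + f N                          ∎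

  ∑-reverse : ∀ N (f : ℕ → Carrier) → ∑[ k ≤ N ] f (toℕ k) ≈ ∑[ k ≤ N ] f (N ∸ toℕ k)
  ∑-reverse N f = begin
    ∑[ k ≤ N ] f (toℕ k)             ≈⟨ ∑-permute (λ (k : Fin (suc N)) → f (toℕ k)) reverse ⟩
    ∑[ k ≤ N ] f (toℕ (opposite k))  ≡⟨ sum-cong-≗ {suc N} (λ k → cong f (opposite-prop k)) ⟩
    ∑[ k ≤ N ] f (N ∸ toℕ k)         ∎

  -- The integer exponent `z` is a variable so that matching its equation with `refl` reduces the
  -- integer power to a natural one.
  [c^n]^k*c^z≈c^p : ∀ c (c#0 : c # 0#) n k {p z} → n ℕ.* k ≤ p → z ≡ + (p ∸ n ℕ.* k) →
                    (c ^ n) ^ k * c ^ℤ z [ c#0 ] ≈ c ^ p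
  [c^n]^k*c^z≈c^p c c#0 n k {p} nk≤p ≡.refl = begin
    (c ^ n) ^ k * c ^ (p ∸ n ℕ.* k)    ≈⟨ *-congʳ (^-assocʳ c n k) ⟩
    c ^ (n ℕ.* k) * c ^ (p ∸ n ℕ.* k)  ≈⟨ ^-homo-* c (n ℕ.* k) (p ∸ n ℕ.* k) ⟨
    c ^ (n ℕ.* k ℕ.+ (p ∸ n ℕ.* k))    ≈⟨ ^-congʳ c (ℕ.m+[n∸m]≡n nk≤p) ⟩
    c ^ p                              ∎

  numerator≈c*denominator : ∀ n m .{{_ : NonZero n}} → 2 ≤ n → m % n ≡ 1 →
    ∀ c (c#0 : c # 0#) → numerator n m (c ^ n) c c#0 ≈ c * denominator n m (c ^ n) c c#0
  numerator≈c*denominator n m 2≤n m%n≡1 c c#0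
    rewrite ⌈m/n⌉≡1+[m/n] m n m%n≡1 = go m (m / n) (%≡1⇒≡1+n*[m/n] m n m%n≡1)
    where
    numTerm denTerm : ℕ → ℕ → Carrier
    numTerm m k = (m C (n ℕ.* k)) · ((c ^ n) ^ k * c ^ℤ (+ m ℤ.- + (n ℕ.* k)) [ c#0 ])
    denTerm m k = (m C (n ℕ.* k ℕ.+ 1)) ·
                  ((c ^ n) ^ k * c ^ℤ (+ m ℤ.- + (n ℕ.* k) ℤ.- + 1) [ c#0 ])

    -- Generalised over `m` and `q`: `m / n` itself contains `m`, so the equation could not be
    -- matched with `refl` otherwise.
    go : ∀ m q → m ≡ suc (n ℕ.* q) →
         ∑[ k ≤ suc q ] numTerm m (toℕ k) ≈ c * ∑[ k ≤ q ] denTerm m (toℕ k)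
    go m q ≡.refl = begin
      ∑[ k ≤ suc q ] numTerm m (toℕ k)                  ≈⟨ ∑-snoc (suc q) (numTerm m) ⟩
      -- The extra numerator term carries a negative power of `c`, but its binomial coefficient is
      -- zero.
      ∑[ k ≤ q ] numTerm m (toℕ k) + numTerm m (suc q)  ≈⟨ +-congˡ (×-congˡ (k>n⇒nCk≡0 m<n[1+q])) ⟩
      ∑[ k ≤ q ] numTerm m (toℕ k) + 0#                 ≈⟨ +-identityʳ _ ⟩
      ∑[ k ≤ q ] numTerm m (toℕ k)                      ≈⟨ ∑-reverse q (numTerm m) ⟩
      ∑[ k ≤ q ] numTerm m (q ∸ toℕ k)                  ≈⟨ sum-cong-≋ {suc q} (λ k → reflect (toℕ≤pred[n] k)) ⟩
      ∑[ k ≤ q ] (c * denTerm m (toℕ k))                ≈⟨ *-distribˡ-sum c (λ (k : Fin (suc q)) → denTerm m (toℕ k)) ⟨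
      c * ∑[ k ≤ q ] denTerm m (toℕ k)                  ∎
      where
      m<n[1+q] : m ℕ.< n ℕ.* suc q
      -- `2 ≤ n` shifted by `nq` reads `1 + nq < n + nq`.
      m<n[1+q] = ≡.subst (m ℕ.<_) (≡.sym (ℕ.*-suc n q)) (ℕ.+-monoˡ-≤ (n ℕ.* q) 2≤n)

      numPower : ∀ {k} → k ≤ q → (c ^ n) ^ k * c ^ℤ (+ m ℤ.- + (n ℕ.* k)) [ c#0 ] ≈ c ^ m
      numPower {k} k≤q = [c^n]^k*c^z≈c^p c c#0 n k nk≤m (+m-+n≡+[m∸n] nk≤m)
        where nk≤m = ℕ.m≤n⇒m≤1+n (ℕ.*-monoʳ-≤ n k≤q)

      denPower : ∀ {k} → k ≤ q →
        (c ^ n) ^ k * c ^ℤ (+ m ℤ.- + (n ℕ.* k) ℤ.- + 1) [ c#0 ] ≈ c ^ (n ℕ.* q)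
      denPower {k} k≤q = [c^n]^k*c^z≈c^p c c#0 n k nk≤nq exponent
        where
        nk≤nq = ℕ.*-monoʳ-≤ n k≤q
        exponent : + m ℤ.- + (n ℕ.* k) ℤ.- + 1 ≡ + (n ℕ.* q ∸ n ℕ.* k)
        -- Once the difference is written as a successor, subtracting 1 computes.
        exponent = cong (ℤ._- + 1)
          (≡.trans (+m-+n≡+[m∸n] (ℕ.m≤n⇒m≤1+n nk≤nq)) (cong +_ (ℕ.+-∸-assoc 1 nk≤nq)))

      reflect : ∀ {k} → k ≤ q → numTerm m (q ∸ k) ≈ c * denTerm m k
      reflect {k} k≤q = begin
        -- Since `m` is `suc (nq)`, `c ^ m` unfolds to `c * c ^ (nq)`, which supplies the factor
        -- `c`.
        numTerm m (q ∸ k)                            ≈⟨ ×-cong (C-reflect n k≤q) (numPower (ℕ.m∸n≤m q k)) ⟩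
        (m C (n ℕ.* k ℕ.+ 1)) · (c * c ^ (n ℕ.* q))  ≈⟨ ×-comm-* (m C (n ℕ.* k ℕ.+ 1)) c _ ⟨
        c * (m C (n ℕ.* k ℕ.+ 1)) · c ^ (n ℕ.* q)    ≈⟨ *-congˡ (×-congʳ (m C (n ℕ.* k ℕ.+ 1)) (denPower k≤q)) ⟨
        c * denTerm m k                              ∎

  x≈z*y⇒x/y≈z : ∀ {x y z} (y#0 : y # 0#) → x ≈ z * y → x / y [ y#0 ] ≈ z
  x≈z*y⇒x/y≈z {x} {y} {z} y#0 x≈zy = begin
    x * recip y y#0        ≈⟨ *-congʳ x≈zy ⟩
    z * y * recip y y#0    ≈⟨ *-assoc z y _ ⟩
    z * (y * recip y y#0)  ≈⟨ *-congˡ (*-recip y y#0) ⟩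
    z * 1#                 ≈⟨ *-identityʳ z ⟩
    z                      ∎

theorem3p6 : ∀ {a ℓ₁ ℓ₂} (ℝ : RealNumbers a ℓ₁ ℓ₂) →
    let open RealNumbers ℝ
        open Biroot ℝ in
    (n m : ℕ) .{{_ : NonZero n}} .{{_ : NonZero m}} →
    2 ≤ n →
    m % n ≡ 1 % n →
    (c : Carrier) (0<c : 0# < c) →
    β n m (c ^ n) c (^-pos n 0<c) 0<c ≈ c
theorem3p6 ℝ n m 2≤n m≡1 c 0<c = x≈z*y⇒x/y≈z ℝ _
  -- `2 ≤ n` is by definition `1 < n`, hence `1 % n` equals 1.
  (numerator≈c*denominator ℝ n m 2≤n (≡.trans m≡1 (m<n⇒m%n≡m 2≤n)) c _)
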